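{- Let $\Sigma^\nabla$ be an intersection-type theory. The following are equivalent: (1) for all $\nabla$-bases $\Gamma$, $\lambda$-terms $M$ and types $A\in\mathsf{T}^\nabla$, $\Gamma\models^\nabla_s M:A$ (satisfiability in the simple semantics) implies $\Gamma\vdash^\nabla M:A$; (2) either $\Sigma^\nabla$ is a strict type theory such that $\nu\notin\mathsf{C}^\nabla$, or $\Sigma^\nabla$ is a natural type theory which validates the axiom ($\Omega$-$\eta$): $\Omega\le\Omega\to\Omega$.
   Context: **Types and theories.** Given a set $\mathsf{C}$ of type constants, $\mathsf{T}(\mathsf{C})$ is generated by $\mathsf{T}=\mathsf{C}\mid \mathsf{T}\to\mathsf{T}\mid\mathsf{T}\cap\mathsf{T}$. Let $\nabla^0$ consist of the axioms $A\le A$; $A\le A\cap A$; $A\cap B\le A$; $A\cap B\le B$; and the rules: $A\le A'$, $B\le B'$ imply $A\cap B\le A'\cap B'$; $A\le B$, $B\le C$ imply $A\le C$. Given a collection $\nabla$ of further axioms and rules for judgments $A\le B$ over $\mathsf{T}(\mathsf{C})$, the intersection-type theory $\Sigma^\nabla=\Sigma(\mathsf{C},\nabla)$ is the set of judgments $A\le B$ derivable from $\nabla^0\cup\nabla$. Write $\mathsf{C}^\nabla=\mathsf{C}$, $\mathsf{T}^\nabla=\mathsf{T}(\mathsf{C})$, $A\le_\nabla B$ for $(A\le B)\in\Sigma^\nabla$, and $A\sim_\nabla B$ for $A\le_\nabla B\le_\nabla A$. $\Sigma^\nabla$ *validates* a collection of axioms and rules if all of them are admissible in $\Sigma^\nabla$.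 There are two special constants $\Omega,\nu$. Standing assumptions: $\Omega$ and $\nu$ are not both in $\mathsf{C}^\nabla$; if $\Omega\in\mathsf{C}^\nabla$ then $\nabla$ contains the axiom $(\Omega)$: $A\le\Omega$; if $\nu\in\mathsf{C}^\nabla$ then $\nabla$ contains the axiom $(\nu)$: $A\to B\le\nu$. Axioms and rules: ($\to$-$\cap$): $(A\to B)\cap(A\to C)\le A\to B\cap C$ (here $\cap$ binds tighter than $\to$); ($\eta$): $A'\le A$ and $B\le B'$ imply $A\to B\le A'\to B'$; ($\Omega$-lazy): $A\to B\le\Omega\to\Omega$. $\Sigma^\nabla$ is *strict* if $\Omega\notin\mathsf{C}^\nabla$ and it validates ($\to$-$\cap$) and ($\eta$). $\Sigma^\nabla$ is *natural* if $\Omega\in\mathsf{C}^\nabla$ and it validates ($\to$-$\cap$), ($\eta$), ($\Omega$) and ($\Omega$-lazy). **Type assignment.** A $\nabla$-basis $\Gamma$ is a set of statements $x:B$ with $x$ a term variable and $B\in\mathsf{T}^\nabla$, all of whose variables are distinct. Judgments $\Gamma\vdash^\nabla M:A$ ($M$ an untyped $\lambda$-term, $A\in\mathsf{T}^\nabla$) are derived by: (Ax) $\Gamma\vdash^\nabla x:A$ if $(x:A)\in\Gamma$; ($\to$I) from $\Gamma,x:A\vdash^\nabla M:B$ infer $\Gamma\vdash^\nabla\lambda x.M:A\to B$; ($\to$E) from $\Gamma\vdash^\nabla M:A\to B$ and $\Gamma\vdash^\nabla N:A$ infer $\Gamma\vdash^\nabla MN:B$; ($\cap$I) from $\Gamma\vdash^\nabla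 M:A$ and $\Gamma\vdash^\nabla M:B$ infer $\Gamma\vdash^\nabla M:A\cap B$; ($\le_\nabla$) from $\Gamma\vdash^\nabla M:A$ and $A\le_\nabla B$ infer $\Gamma\vdash^\nabla M:B$; moreover, if $\Omega\in\mathsf{C}^\nabla$, (Ax-$\Omega$) $\Gamma\vdash^\nabla M:\Omega$ for every $M$; if $\nu\in\mathsf{C}^\nabla$, (Ax-$\nu$) $\Gamma\vdash^\nabla\lambda x.M:\nu$ for every $x,M$. **Semantics.** Let $\Lambda$ be the set of $\lambda$-terms and $\mathrm{Var}$ the set of term variables. A *$\lambda$-applicative structure* is a triple $\langle\mathcal D,\cdot,[\![\;]\!]^{\mathcal D}\rangle$ where $\langle\mathcal D,\cdot\rangle$ is an applicative structure (a set with a binary operation) and $[\![\;]\!]^{\mathcal D}:\Lambda\times(\mathrm{Var}\to\mathcal D)\to\mathcal D$, $(M,\rho)\mapsto[\![M]\!]^{\mathcal D}_\rho$, is an interpretation function for $\lambda$-terms. A *type interpretation domain* is $\mathcal I=\langle\mathcal D,\cdot,[\![\;]\!]^{\mathcal D},\Phi\rangle$ where $\langle\mathcal D,\cdot,[\![\;]\!]^{\mathcal D}\rangle$ is a $\lambda$-applicative structure and $\Phi\subseteq\mathcal D$ satisfies $[\![\lambda x.M]\!]^{\mathcal D}_\rho\in\Phi$ for all $x,M,\rho$. It is a *simple interpretation domain* if $\Phi=\mathcal D$. Given a type environment $\mathcal V:\mathsf{C}^\nabla\to\mathsf P(\mathcal D)$ ($\mathsf P$ = powerset), put $[\![\Omega]\!]^{\mathcal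 I}_{\mathcal V}=\mathcal D$; $[\![\nu]\!]^{\mathcal I}_{\mathcal V}=\Phi$; $[\![\psi]\!]^{\mathcal I}_{\mathcal V}=\mathcal V(\psi)$ for other constants $\psi$; $[\![A\to B]\!]^{\mathcal I}_{\mathcal V}=\{X\in\Phi\mid\forall Y\in[\![A]\!]^{\mathcal I}_{\mathcal V}.\ X\cdot Y\in[\![B]\!]^{\mathcal I}_{\mathcal V}\}$; $[\![A\cap B]\!]^{\mathcal I}_{\mathcal V}=[\![A]\!]^{\mathcal I}_{\mathcal V}\cap[\![B]\!]^{\mathcal I}_{\mathcal V}$. A term environment $\rho:\mathrm{Var}\to\mathcal D$ is *good* if $[\![x]\!]^{\mathcal D}_\rho=\rho(x)$ for all $x\in\mathrm{Var}$ and there are terms $M,N$ with $[\![M]\!]^{\mathcal D}_\rho\ne[\![N]\!]^{\mathcal D}_\rho$. The pair $\mathcal I,\mathcal V$ is *$\nabla$-good* if for all $A,B\in\mathsf{T}^\nabla$: (a) for all good $\rho$, all variables $x$ and all $d\in[\![A]\!]^{\mathcal I}_{\mathcal V}$, $\rho[x:=d]$ is good; (b) for all good $\rho$, terms $M$, variables $x$: if $[\![M]\!]^{\mathcal D}_{\rho[x:=d]}\in[\![B]\!]^{\mathcal I}_{\mathcal V}$ for all $d\in[\![A]\!]^{\mathcal I}_{\mathcal V}$, then $[\![\lambda x.M]\!]^{\mathcal D}_\rho\in[\![A\to B]\!]^{\mathcal I}_{\mathcal V}$. The pair *agrees* with $\Sigma^\nabla$ if $A\le_\nabla B$ implies $[\![A]\!]^{\mathcal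 I}_{\mathcal V}\subseteq[\![B]\!]^{\mathcal I}_{\mathcal V}$ for all $A,B\in\mathsf{T}^\nabla$. Write $\mathcal I,\rho,\mathcal V\models M:A$ iff $[\![M]\!]^{\mathcal D}_\rho\in[\![A]\!]^{\mathcal I}_{\mathcal V}$, and $\mathcal I,\rho,\mathcal V\models\Gamma$ iff $\mathcal I,\rho,\mathcal V\models x:B$ for all $(x:B)\in\Gamma$. *Simple semantics*: $\Gamma\models^\nabla_s M:A$ iff for all simple interpretation domains $\mathcal I$ and type environments $\mathcal V$ such that $\mathcal I,\mathcal V$ is $\nabla$-good and agrees with $\Sigma^\nabla$, and all good term environments $\rho$, $\mathcal I,\rho,\mathcal V\models\Gamma$ implies $\mathcal I,\rho,\mathcal V\models M:A$. -}

module Defs where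

open import Algebra.Bundles using (Magma)
open import Data.Bool.Base using (Bool; T; if_then_else_)
open import Data.Fin.Base using (Fin; fromℕ; inject₁)
open import Data.List.Base using (List; []; _∷_)
open import Data.List.Relation.Unary.All using (All)
open import Data.Maybe.Base using (Maybe; just)
open import Data.Nat.Base using (ℕ; suc)
open import Data.Nat.Properties using (_≟_)
open import Data.Product.Base using (Σ-syntax; ∃-syntax; _×_; proj₁)
open import Data.Unit.Polymorphic.Base using (⊤)
open import Level using (Level; 0ℓ) renaming (suc to lsuc)
open import Relation.Binary.Construct.Union using (_∪_)
open import Relation.Binary.Core using (REL)
open import Relation.Binary.Definitions using (_Respects_)
open import Relation.Binary.PropositionalEquality.Core using (_≡_)
open import Relation.Nullary.Decidable.Core using (⌊_⌋)
open import Relation.Nullary.Negation.Core using (¬_)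
open import Relation.Unary using (Pred; _∈_; _⊆_; Universal)

------------------------------------------------------------------------
-- Types

-- A set of type constants is given by its constants other than Ω and ν,
-- together with whether it contains Ω and whether it contains ν.

record Constants : Set₁ where
  field
    Ordinary : Set
    hasΩ     : Bool
    hasν     : Bool

  Ω∈C : Set
  Ω∈C = T hasΩ

  ν∈C : Set
  ν∈C = T hasν

open Constants public using (Ω∈C; ν∈C)

data Constant (C : Constants) : Set where
  Ω        : .(Ω∈C C) → Constant C
  ν        : .(ν∈C C) → Constant C
  ordinary : Constants.Ordinary C → Constant C

infixr 7 _⇒_
infixl 8 _∩_

data Type (C : Constants) : Set where
  con : Constant C → Type C
  _⇒_ : Type C → Type C → Type C
  _∩_ : Type C → Type C → Type C

------------------------------------------------------------------------
-- Axioms and rules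

infix 5 _≤_

data Judgment (C : Constants) : Set where
  _≤_ : Type C → Type C → Judgment C

-- A collection of axioms and rules is identified with the set of its
-- instances over the types of C, each consisting of a list of premises
-- and a conclusion; axioms have no premises. The schemes below that
-- mention Ω or ν have no instances if that constant is not in C.

Rules : Constants → Set₁
Rules C = REL (List (Judgment C)) (Judgment C) 0ℓ

module _ {C : Constants} where

  infix 4 _Contains_

  _Contains_ : Rules C → Rules C → Set
  R Contains S = ∀ {ps c} → S ps c → R ps c

  data ∇⁰ : Rules C where
    ≤-refl  : ∀ {A} → ∇⁰ [] (A ≤ A)
    ≤-idem  : ∀ {A} → ∇⁰ [] (A ≤ A ∩ A)
    ≤-inclˡ : ∀ {A B} → ∇⁰ [] (A ∩ B ≤ A)
    ≤-inclʳ : ∀ {A B} → ∇⁰ [] (A ∩ B ≤ B)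
    ≤-mono  : ∀ {A A′ B B′} →
              ∇⁰ ((A ≤ A′) ∷ (B ≤ B′) ∷ []) (A ∩ B ≤ A′ ∩ B′)
    ≤-trans : ∀ {A B D} → ∇⁰ ((A ≤ B) ∷ (B ≤ D) ∷ []) (A ≤ D)

  data Ω-axiom : Rules C where
    ax : ∀ {A} .(p : Ω∈C C) → Ω-axiom [] (A ≤ con (Ω p))

  data ν-axiom : Rules C where
    ax : ∀ {A B} .(p : ν∈C C) → ν-axiom [] (A ⇒ B ≤ con (ν p))

  data ⇒-∩ : Rules C where
    ax : ∀ {A B D} → ⇒-∩ [] ((A ⇒ B) ∩ (A ⇒ D) ≤ A ⇒ B ∩ D)

  data η : Rules C where
    rule : ∀ {A A′ B B′} →
           η ((A′ ≤ A) ∷ (B ≤ B′) ∷ []) (A ⇒ B ≤ A′ ⇒ B′)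

  data Ω-lazy : Rules C where
    ax : ∀ {A B} .(p : Ω∈C C) →
         Ω-lazy [] (A ⇒ B ≤ con (Ω p) ⇒ con (Ω p))

  data Ω-η : Rules C where
    ax : .(p : Ω∈C C) → Ω-η [] (con (Ω p) ≤ con (Ω p) ⇒ con (Ω p))

  data Derivable (R : Rules C) : Judgment C → Set where
    by : ∀ {ps c} → R ps c → All (Derivable R) ps → Derivable R c

------------------------------------------------------------------------
-- Intersection-type theories

record TypeTheory : Set₁ where
  field
    C       : Constants
    ∇       : Rules C
    ¬Ω×ν    : ¬ (Ω∈C C × ν∈C C)
    Ω-in-∇  : Ω∈C C → ∇ Contains Ω-axiom
    ν-in-∇  : ν∈C C → ∇ Contains ν-axiom

Ty : TypeTheory → Set
Ty 𝒯 = Type (TypeTheory.C 𝒯)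

HasΩ : TypeTheory → Set
HasΩ 𝒯 = Ω∈C (TypeTheory.C 𝒯)

Hasν : TypeTheory → Set
Hasν 𝒯 = ν∈C (TypeTheory.C 𝒯)

module _ (𝒯 : TypeTheory) where
  open TypeTheory 𝒯

  InTheory : Judgment C → Set
  InTheory = Derivable (∇⁰ ∪ ∇)

  Validates : Rules C → Set
  Validates R = ∀ {ps c} → R ps c → All InTheory ps → InTheory c

  record Strict : Set where
    field
      Ω∉C : ¬ HasΩ 𝒯
      v⇒∩ : Validates ⇒-∩
      vη  : Validates η

  record Natural : Set where
    field
      Ω∈     : HasΩ 𝒯
      v⇒∩    : Validates ⇒-∩
      vη     : Validates η
      vΩ     : Validates Ω-axiom
      vΩlazy : Validates Ω-lazy

------------------------------------------------------------------------
-- λ-terms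

Var : Set
Var = ℕ

-- λ-terms modulo α-equivalence, with named free variables and de Bruijn
-- bound variables: an element of Term n may refer to n enclosing
-- binders, index zero being the innermost.

infixl 7 _·_

data Term (n : ℕ) : Set where
  free  : Var → Term n
  bound : Fin n → Term n
  _·_   : Term n → Term n → Term n
  lam   : Term (suc n) → Term n

Λ : Set
Λ = Term 0

-- Binds the free occurrences of x by a new outermost binder.

close : ∀ {n} → Var → Term n → Term (suc n)
close {n} x (free y)  = if ⌊ y ≟ x ⌋ then bound (fromℕ n) else free y
close     x (bound i) = bound (inject₁ i)
close     x (M · N)   = close x M · close x N
close     x (lam M)   = lam (close x M)

-- The named abstraction λx.M. Every lam N is of this form.

ƛ : Var → Λ → Λ
ƛ x M = lam (close x M)

infixl 8 _[_≔_]

_[_≔_] : ∀ {a} {A : Set a} → (Var → A) → Var → A → Var → A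
(f [ x ≔ a ]) y = if ⌊ y ≟ x ⌋ then a else f y

------------------------------------------------------------------------
-- Type assignment

-- A set of statements x : B with distinct variables is a partial
-- function from variables to types; it need not be finite.

Basis : TypeTheory → Set
Basis 𝒯 = Var → Maybe (Ty 𝒯)

data Derivation (𝒯 : TypeTheory) (Γ : Basis 𝒯) : Λ → Ty 𝒯 → Set

infix 4 Derivation
syntax Derivation 𝒯 Γ M A = Γ ⊢[ 𝒯 ] M ∶ A

-- In ⇒I, the basis Γ, x : A assigns A to x in place of any statement
-- about x in Γ. Under the convention that bound variables are fresh
-- nothing is replaced; as Γ may declare every variable, a fresh one need
-- not exist.

data Derivation 𝒯 Γ where
  Ax   : ∀ {x A} → Γ x ≡ just A → Γ ⊢[ 𝒯 ] free x ∶ A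
  ⇒I   : ∀ x M {A B} → (Γ [ x ≔ just A ]) ⊢[ 𝒯 ] M ∶ B → Γ ⊢[ 𝒯 ] ƛ x M ∶ A ⇒ B
  ⇒E   : ∀ {M N A B} → Γ ⊢[ 𝒯 ] M ∶ A ⇒ B → Γ ⊢[ 𝒯 ] N ∶ A → Γ ⊢[ 𝒯 ] M · N ∶ B
  ∩I   : ∀ {M A B} → Γ ⊢[ 𝒯 ] M ∶ A → Γ ⊢[ 𝒯 ] M ∶ B → Γ ⊢[ 𝒯 ] M ∶ A ∩ B
  sub  : ∀ {M A B} → Γ ⊢[ 𝒯 ] M ∶ A → InTheory 𝒯 (A ≤ B) → Γ ⊢[ 𝒯 ] M ∶ B
  Ax-Ω : ∀ {M} .(p : HasΩ 𝒯) → Γ ⊢[ 𝒯 ] M ∶ con (Ω p)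
  Ax-ν : ∀ x M .(p : Hasν 𝒯) → Γ ⊢[ 𝒯 ] ƛ x M ∶ con (ν p)

------------------------------------------------------------------------
-- Semantics

-- Since quotients are not available, a set is rendered by a setoid:
-- operations and subsets respect its equality. The interpretation
-- function is otherwise arbitrary.

record λ-ApplicativeStructure (ℓ : Level) : Set (lsuc ℓ) where
  field
    𝒟 : Magma ℓ ℓ

  open Magma 𝒟 public using (Carrier; _≈_; _≉_; _∙_)

  Env : Set ℓ
  Env = Var → Carrier

  field
    ⟦_⟧      : Λ → Env → Carrier
    ⟦⟧-cong  : ∀ M {ρ σ} → (∀ x → ρ x ≈ σ x) → ⟦ M ⟧ ρ ≈ ⟦ M ⟧ σ

  Subset : Set (lsuc ℓ)
  Subset = Σ[ P ∈ Pred Carrier ℓ ] P Respects _≈_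

  record Good (ρ : Env) : Set ℓ where
    field
      variables  : ∀ x → ⟦ free x ⟧ ρ ≈ ρ x
      nontrivial : ∃[ M ] ∃[ N ] ⟦ M ⟧ ρ ≉ ⟦ N ⟧ ρ

record InterpretationDomain (ℓ : Level) : Set (lsuc ℓ) where
  field
    structure : λ-ApplicativeStructure ℓ

  open λ-ApplicativeStructure structure public

  field
    Φ  : Subset
    ƛ∈Φ : ∀ x M ρ → ⟦ ƛ x M ⟧ ρ ∈ proj₁ Φ

  Simple : Set ℓ
  Simple = Universal (proj₁ Φ)

module _ {ℓ : Level} (𝒯 : TypeTheory) (ℐ : InterpretationDomain ℓ) where
  open InterpretationDomain ℐ

  -- The values of 𝒱 at Ω and ν, if present, play no role.

  TypeEnv : Set (lsuc ℓ)
  TypeEnv = Constant (TypeTheory.C 𝒯) → Subset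

  ⟦_⟧ᵗ : Ty 𝒯 → TypeEnv → Pred Carrier ℓ
  ⟦ con (Ω _)        ⟧ᵗ 𝒱 X = ⊤
  ⟦ con (ν _)        ⟧ᵗ 𝒱 X = X ∈ proj₁ Φ
  ⟦ con (ordinary ψ) ⟧ᵗ 𝒱 X = X ∈ proj₁ (𝒱 (ordinary ψ))
  ⟦ A ⇒ B            ⟧ᵗ 𝒱 X =
    X ∈ proj₁ Φ × (∀ Y → Y ∈ ⟦ A ⟧ᵗ 𝒱 → (X ∙ Y) ∈ ⟦ B ⟧ᵗ 𝒱)
  ⟦ A ∩ B            ⟧ᵗ 𝒱 X = X ∈ ⟦ A ⟧ᵗ 𝒱 × X ∈ ⟦ B ⟧ᵗ 𝒱

  record ∇-Good (𝒱 : TypeEnv) : Set ℓ where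
    field
      good-[≔] : ∀ (A : Ty 𝒯) ρ → Good ρ → ∀ x d →
                 d ∈ ⟦ A ⟧ᵗ 𝒱 → Good (ρ [ x ≔ d ])
      good-ƛ   : ∀ (A B : Ty 𝒯) ρ → Good ρ → ∀ M x →
                 (∀ d → d ∈ ⟦ A ⟧ᵗ 𝒱 → ⟦ M ⟧ (ρ [ x ≔ d ]) ∈ ⟦ B ⟧ᵗ 𝒱) →
                 ⟦ ƛ x M ⟧ ρ ∈ ⟦ A ⇒ B ⟧ᵗ 𝒱

  Agrees : TypeEnv → Set ℓ
  Agrees 𝒱 = ∀ A B → InTheory 𝒯 (A ≤ B) → ⟦ A ⟧ᵗ 𝒱 ⊆ ⟦ B ⟧ᵗ 𝒱

  Satisfies : Env → TypeEnv → Λ → Ty 𝒯 → Set ℓ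
  Satisfies ρ 𝒱 M A = ⟦ M ⟧ ρ ∈ ⟦ A ⟧ᵗ 𝒱

  SatisfiesBasis : Env → TypeEnv → Basis 𝒯 → Set ℓ
  SatisfiesBasis ρ 𝒱 Γ =
    ∀ x B → Γ x ≡ just B → Satisfies ρ 𝒱 (free x) B

-- Γ ⊨ₛ M : A, over the domains of level ℓ.

SimplySatisfies : ∀ (ℓ : Level) (𝒯 : TypeTheory) →
                  Basis 𝒯 → Λ → Ty 𝒯 → Set (lsuc ℓ)
SimplySatisfies ℓ 𝒯 Γ M A =
  ∀ (ℐ : InterpretationDomain ℓ) (𝒱 : TypeEnv 𝒯 ℐ) →
  InterpretationDomain.Simple ℐ → ∇-Good 𝒯 ℐ 𝒱 → Agrees 𝒯 ℐ 𝒱 →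
  ∀ ρ → InterpretationDomain.Good ℐ ρ →
  SatisfiesBasis 𝒯 ℐ ρ 𝒱 Γ → Satisfies 𝒯 ℐ ρ 𝒱 M A

infix 4 SimplySatisfies
syntax SimplySatisfies ℓ 𝒯 Γ M A = Γ ⊨ₛ[ 𝒯 , ℓ ] M ∶ A

{-# OPTIONS --safe #-}

-- Completeness ⇒ conditions: each scheme holds in every simple
-- interpretation agreeing with the theory, so it is transferred to the
-- theory by typing a single variable.
--
-- Conditions ⇒ completeness: interpret a term as the set of its types,
-- computed by recursion on the term. The conditions make these sets closed
-- under ∩ and ≤, application included, and then the value of A is the set
-- of all points having the type A. A set of types is too large to be a
-- point at level zero, so the points are codes for such sets: principal
-- ones, and closures of a term with an environment.

module Submission where

open import Defs
open import Algebra.Bundles using (Magma)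
open import Data.Bool.Base using (Bool; true; false)
open import Data.Bool.Properties using (T?)
open import Data.Empty using (⊥-elim; ⊥-elim-irr)
open import Data.Fin.Base using (zero; suc; fromℕ; inject₁)
open import Data.Fin.Relation.Unary.Top using (view; ‵fromℕ; ‵inject₁)
open import Data.List.Base using ([]; _∷_)
open import Data.List.Relation.Unary.All using ([]; _∷_)
open import Data.Maybe.Base using (Maybe; just; nothing)
open import Data.Nat.Base using (ℕ; zero; suc; _+_; _⊔_; _<_; s≤s) renaming (_≤_ to _≤ⁿ_)
open import Data.Nat.Induction using (<-wellFounded)
open import Data.Nat.Properties
  using (_≟_; <-irrefl; m≤m+n; m≤n+m; m≤m⊔n; m≤n⊔m; ≤-reflexive)
  renaming (≤-refl to ≤ⁿ-refl; ≤-trans to ≤ⁿ-trans)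
open import Data.Product using (_×_; _,_; ∃-syntax; proj₁; proj₂)
open import Data.Sum using (_⊎_; inj₁; inj₂; [_,_])
open import Data.Unit.Polymorphic.Base using (⊤; tt)
open import Data.Vec.Base as Vec using (Vec; lookup)
open import Function.Base using (_∘_)
open import Function.Bundles using (_⇔_; mk⇔)
open import Induction.WellFounded using (Acc; acc)
open import Level using (Level; Lift; lift; lower; 0ℓ)
open import Relation.Binary.PropositionalEquality.Core
  using (_≡_; refl; sym; trans; cong; cong₂)
open import Relation.Nullary using (¬_; yes; no; recompute)
open import Relation.Unary using (Pred; _⊆_; _≐_)
open import Relation.Unary.Properties using (≐-refl; ≐-sym; ≐-trans)

-- Opening a bound variable in a λ-term.

size : ∀ {n} → Term n → ℕ
size (free _)  = 0
size (bound _) = 0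
size (M · N)   = suc (size M + size N)
size (lam M)   = suc (size M)

close-fresh : ∀ {n x y} → y < x → close {n} x (free y) ≡ free y
close-fresh {x = x} {y} y<x with y ≟ x
... | yes refl = ⊥-elim (<-irrefl refl y<x)
... | no  _    = refl

close-self : ∀ {n} x → close {n} x (free x) ≡ bound (fromℕ n)
close-self x with x ≟ x
... | yes _  = refl
... | no x≢x = ⊥-elim (x≢x refl)

-- Any `x` above all free variables can name the outermost binder without capture. Allowing every
-- `x` from `b` on lets an application take the maximum of two bounds; the size equation serves the
-- recursion of `types-⊢`.
unclose : ∀ {n} (N : Term (suc n)) →
          ∃[ b ] ∀ x → b ≤ⁿ x → ∃[ M ] close x M ≡ N × size M ≡ size N
unclose (free y) = suc y , λ x y<x → free y , close-fresh y<x , refl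
unclose (bound i) with view i
... | ‵fromℕ     = 0 , λ x _ → free x , close-self x , refl
... | ‵inject₁ j = 0 , λ x _ → bound j , refl , refl
unclose (N · N′) with unclose N | unclose N′
... | b , u | b′ , u′ = b ⊔ b′ , λ x b⊔b′≤x →
  let M  , eq  , sz  = u  x (≤ⁿ-trans (m≤m⊔n b b′) b⊔b′≤x)
      M′ , eq′ , sz′ = u′ x (≤ⁿ-trans (m≤n⊔m b b′) b⊔b′≤x)
  in M · M′ , cong₂ _·_ eq eq′ , cong suc (cong₂ _+_ sz sz′)
unclose (lam N) with unclose N
... | b , u = b , λ x b≤x →
  let M , eq , sz = u x b≤x in lam M , cong lam eq , cong suc sz

-- The preorder of the theory and the typing of variables.

module _ (𝒯 : TypeTheory) where
  open TypeTheory 𝒯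

  infix 4 _⊑_

  _⊑_ : Ty 𝒯 → Ty 𝒯 → Set
  A ⊑ B = InTheory 𝒯 (A ≤ B)

  ⊑-refl : ∀ {A} → A ⊑ A
  ⊑-refl = by (inj₁ ≤-refl) []

  ⊑-trans : ∀ {A B D} → A ⊑ B → B ⊑ D → A ⊑ D
  ⊑-trans p q = by (inj₁ ≤-trans) (p ∷ q ∷ [])

  ∩-lowerˡ : ∀ {A B} → A ∩ B ⊑ A
  ∩-lowerˡ = by (inj₁ ≤-inclˡ) []

  ∩-lowerʳ : ∀ {A B} → A ∩ B ⊑ B
  ∩-lowerʳ = by (inj₁ ≤-inclʳ) []

  ∩-greatest : ∀ {A B D} → D ⊑ A → D ⊑ B → D ⊑ A ∩ B
  ∩-greatest p q = ⊑-trans (by (inj₁ ≤-idem) []) (by (inj₁ ≤-mono) (p ∷ q ∷ []))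

  Ω-top : ∀ {A} .(p : HasΩ 𝒯) → A ⊑ con (Ω p)
  Ω-top p = by (inj₂ (Ω-in-∇ (recompute (T? _) p) (ax p))) []

  -- Only `Ax`, `∩I`, `sub` and `Ax-Ω` can type a variable, and each stays above the declared type.
  -- This turns typability of a variable into a judgment of the theory.
  ⊢-variable : ∀ {Γ : Basis 𝒯} {x A B} →
               Γ x ≡ just A → Γ ⊢[ 𝒯 ] free x ∶ B → A ⊑ B
  ⊢-variable Γx (Ax Γx′) with refl ← trans (sym Γx) Γx′ = ⊑-refl
  ⊢-variable Γx (∩I p q)  = ∩-greatest (⊢-variable Γx p) (⊢-variable Γx q)
  ⊢-variable Γx (sub p l) = ⊑-trans (⊢-variable Γx p) l
  ⊢-variable Γx (Ax-Ω p)  = Ω-top p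

  undeclared-untypable : ∀ {Γ : Basis 𝒯} {x A} →
    ¬ HasΩ 𝒯 → Γ x ≡ nothing → ¬ (Γ ⊢[ 𝒯 ] free x ∶ A)
  undeclared-untypable Ω∉ Γx (Ax Γx′) with () ← trans (sym Γx) Γx′
  undeclared-untypable Ω∉ Γx (∩I p q)  = undeclared-untypable Ω∉ Γx p
  undeclared-untypable Ω∉ Γx (sub p l) = undeclared-untypable Ω∉ Γx p
  undeclared-untypable Ω∉ Γx (Ax-Ω p)  = ⊥-elim-irr (Ω∉ p)

  -- Filters of types.

  -- The filter generated by `P`, with constructors matching `∩I`, `sub` and `Ax-Ω`. If `Ω` is
  -- absent, a filter may be empty.
  data Closure (P : Pred (Ty 𝒯) 0ℓ) : Pred (Ty 𝒯) 0ℓ where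
    incl : P ⊆ Closure P
    meet : ∀ {A B} → Closure P A → Closure P B → Closure P (A ∩ B)
    up   : ∀ {A B} → Closure P A → A ⊑ B → Closure P B
    top  : .(p : HasΩ 𝒯) → Closure P (con (Ω p))

  Closure-extend : ∀ {P Q} → P ⊆ Closure Q → Closure P ⊆ Closure Q
  Closure-extend f (incl p)   = f p
  Closure-extend f (meet c d) = meet (Closure-extend f c) (Closure-extend f d)
  Closure-extend f (up c l)   = up (Closure-extend f c) l
  Closure-extend f (top p)    = top p

  Closure-cong : ∀ {P Q} → P ≐ Q → Closure P ≐ Closure Q
  Closure-cong (f , g) = Closure-extend (λ p → incl (f p)) , Closure-extend (λ q → incl (g q))

  Closed : Pred (Ty 𝒯) 0ℓ → Set
  Closed P = Closure P ⊆ P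

  Closure-closed : ∀ {P} → Closed (Closure P)
  Closure-closed = Closure-extend (λ c → c)

  -- `nothing` yields the least filter, the value of an undeclared variable.
  principal : Maybe (Ty 𝒯) → Pred (Ty 𝒯) 0ℓ
  principal a = Closure (λ A → a ≡ just A)

  principal-least : ∀ {A B} → principal (just A) B → A ⊑ B
  principal-least (incl refl) = ⊑-refl
  principal-least (meet c d)  = ∩-greatest (principal-least c) (principal-least d)
  principal-least (up c l)    = ⊑-trans (principal-least c) l
  principal-least (top p)     = Ω-top p

  principal-cong : ∀ {a b} → a ≡ b → principal a ≐ principal b
  principal-cong refl = ≐-refl

  -- The set of types of a term.

  Apply : Pred (Ty 𝒯) 0ℓ → Pred (Ty 𝒯) 0ℓ → Pred (Ty 𝒯) 0ℓ
  Apply P Q B = ∃[ A ] P (A ⇒ B) × Q A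

  Apply-cong : ∀ {P P′ Q Q′} → P ≐ P′ → Q ≐ Q′ → Apply P Q ≐ Apply P′ Q′
  Apply-cong (f , f′) (g , g′) =
    (λ (A , p , q) → A , f p , g q) , (λ (A , p , q) → A , f′ p , g′ q)

  data Arrows (F : Ty 𝒯 → Pred (Ty 𝒯) 0ℓ) : Pred (Ty 𝒯) 0ℓ where
    arrow : ∀ {A B} → F A B → Arrows F (A ⇒ B)

  Arrows-cong : ∀ {F G} → (∀ A → F A ≐ G A) → Arrows F ≐ Arrows G
  Arrows-cong h = (λ { (arrow p) → arrow (proj₁ (h _) p) })
                , (λ { (arrow p) → arrow (proj₂ (h _) p) })

  -- The filter-model interpretation. A bound variable ranges over principal filters only, so a
  -- single type per binder suffices. No closure is taken at an application; `Apply-closed` supplies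
  -- it.
  types : ∀ {n} → Term n → (Var → Pred (Ty 𝒯) 0ℓ) → Vec (Ty 𝒯) n → Pred (Ty 𝒯) 0ℓ
  types (free x)  ρ Δ = ρ x
  types (bound i) ρ Δ = principal (just (lookup Δ i))
  types (M · N)   ρ Δ = Apply (types M ρ Δ) (types N ρ Δ)
  types (lam M)   ρ Δ = Closure (Arrows (λ A → types M ρ (A Vec.∷ Δ)))

  types-cong : ∀ {n} (M : Term n) {ρ σ Δ} →
               (∀ x → ρ x ≐ σ x) → types M ρ Δ ≐ types M σ Δ
  types-cong (free x)  h = h x
  types-cong (bound i) h = ≐-refl
  types-cong (M · N)   h = Apply-cong (types-cong M h) (types-cong N h)
  types-cong (lam M)   h = Closure-cong (Arrows-cong (λ _ → types-cong M h))

  -- Updating `x` in the environment amounts to putting `A` at the outermost binder, which is the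
  -- last entry of `Δ′`. Separating `f` from `ρ` covers both bases (`f = principal`) and
  -- environments of points.
  types-close : ∀ {a} {X : Set a} (f : X → Pred (Ty 𝒯) 0ℓ) (ρ : Var → X) {d A} →
    f d ≡ principal (just A) → ∀ {n} x (M : Term n) {Δ Δ′} →
    lookup Δ′ (fromℕ n) ≡ A → (∀ i → lookup Δ′ (inject₁ i) ≡ lookup Δ i) →
    types M (f ∘ (ρ [ x ≔ d ])) Δ ≐ types (close x M) (f ∘ ρ) Δ′
  types-close f ρ fd x (free y) last init with y ≟ x
  ... | yes _ rewrite fd = principal-cong (cong just (sym last))
  ... | no  _ = ≐-refl
  types-close f ρ fd x (bound i) last init =
    principal-cong (cong just (sym (init i)))
  types-close f ρ fd x (M · N) last init =
    Apply-cong (types-close f ρ fd x M last init) (types-close f ρ fd x N last init)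
  types-close f ρ fd x (lam M) last init = Closure-cong (Arrows-cong λ _ →
    types-close f ρ fd x M last λ { zero → refl ; (suc i) → init i })

  -- The recursion is on size, since the opened body of an abstraction is not a subterm of it.
  types-⊢ : ∀ (Γ : Basis 𝒯) (M : Λ) → Acc _<_ (size M) →
            ∀ {A} → types M (principal ∘ Γ) Vec.[] A → Γ ⊢[ 𝒯 ] M ∶ A
  types-⊢ Γ (free x) _ = go
    where
    go : ∀ {A} → principal (Γ x) A → Γ ⊢[ 𝒯 ] free x ∶ A
    go (incl Γx)  = Ax Γx
    go (meet c d) = ∩I (go c) (go d)
    go (up c l)   = sub (go c) l
    go (top p)    = Ax-Ω p
  types-⊢ Γ (M · N) (acc rs) (_ , p , q) =
    ⇒E (types-⊢ Γ M (rs (s≤s (m≤m+n _ _))) p) (types-⊢ Γ N (rs (s≤s (m≤n+m _ _))) q)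
  types-⊢ Γ (lam N) (acc rs) with unclose N
  ... | x , u with u x ≤ⁿ-refl
  ... | M , refl , sz = go
    where
    go : ∀ {A} → types (ƛ x M) (principal ∘ Γ) Vec.[] A → Γ ⊢[ 𝒯 ] ƛ x M ∶ A
    go (incl (arrow p)) = ⇒I x M (types-⊢ _ M (rs (s≤s (≤-reflexive sz)))
      (proj₂ (types-close principal Γ refl x M refl (λ ())) p))
    go (meet c d) = ∩I (go c) (go d)
    go (up c l)   = sub (go c) l
    go (top p)    = Ax-Ω p

  -- The filter model under the conditions.

  module FilterModel
    (v⇒∩   : Validates 𝒯 ⇒-∩)
    (vη    : Validates 𝒯 η)
    (Ω⊑Ω⇒Ω : .(p : HasΩ 𝒯) → con (Ω p) ⊑ con (Ω p) ⇒ con (Ω p))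
    (ν∉C   : ¬ Hasν 𝒯)
    where

    ⇒-mono : ∀ {A A′ B B′} → A′ ⊑ A → B ⊑ B′ → A ⇒ B ⊑ A′ ⇒ B′
    ⇒-mono p q = vη rule (p ∷ q ∷ [])

    ∩-⇒-∩ : ∀ {A A′ B B′} → (A ⇒ B) ∩ (A′ ⇒ B′) ⊑ A ∩ A′ ⇒ B ∩ B′
    ∩-⇒-∩ = ⊑-trans
      (∩-greatest (⊑-trans ∩-lowerˡ (⇒-mono ∩-lowerˡ ⊑-refl))
                  (⊑-trans ∩-lowerʳ (⇒-mono ∩-lowerʳ ⊑-refl)))
      (v⇒∩ ax [])

    -- Each closure clause uses its own condition: `meet` needs `⇒-∩` and `η`, `up` needs `η`, and
    -- `top` needs `Ω ≤ Ω ⇒ Ω`.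
    Apply-closed : ∀ {P Q} → Closed P → Closed Q → Closed (Apply P Q)
    Apply-closed cP cQ (incl p) = p
    Apply-closed cP cQ (meet c d) =
      let A  , p  , q  = Apply-closed cP cQ c
          A′ , p′ , q′ = Apply-closed cP cQ d
      in A ∩ A′ , cP (up (meet (incl p) (incl p′)) ∩-⇒-∩) , cQ (meet (incl q) (incl q′))
    Apply-closed cP cQ (up c l) =
      let A , p , q = Apply-closed cP cQ c
      in A , cP (up (incl p) (⇒-mono ⊑-refl l)) , q
    Apply-closed cP cQ (top p) = con (Ω p) , cP (up (top p) (Ω⊑Ω⇒Ω p)) , cQ (top p)

    types-closed : ∀ {n} (M : Term n) {ρ Δ} →
                   (∀ x → Closed (ρ x)) → Closed (types M ρ Δ)
    types-closed (free x)  h = h x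
    types-closed (bound i) h = Closure-closed
    types-closed (M · N)   h = Apply-closed (types-closed M h) (types-closed N h)
    types-closed (lam M)   h = Closure-closed

    data Point : Set where
      gen     : Maybe (Ty 𝒯) → Point
      closure : Λ → (Var → Point) → Point

    typesᵖ : Point → Pred (Ty 𝒯) 0ℓ
    typesᵖ (gen a)       = principal a
    typesᵖ (closure M ρ) = types M (λ x → typesᵖ (ρ x)) Vec.[]

    typesᵖ-closed : ∀ d → Closed (typesᵖ d)
    typesᵖ-closed (gen a)       = Closure-closed
    typesᵖ-closed (closure M ρ) = types-closed M (λ x → typesᵖ-closed (ρ x))

    -- Encoded as the closure of an application of two variables, so that its set of types is
    -- `Apply` of the two sets by definition.
    apply : Point → Point → Point
    apply d e = closure (free 0 · free 1) λ { zero → d ; (suc _) → e }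

    -- All terms may have the same types, so equality of types alone could
    -- make every environment trivial, hence not good.
    isApplication : Point → Bool
    isApplication (gen _)               = false
    isApplication (closure (free x) ρ)  = isApplication (ρ x)
    isApplication (closure (M · N) ρ)   = true
    isApplication (closure (lam M) ρ)   = false

    infix 4 _≅_

    _≅_ : Point → Point → Set
    d ≅ e = typesᵖ d ≐ typesᵖ e × isApplication d ≡ isApplication e

    closure-cong : ∀ M {ρ σ} → (∀ x → ρ x ≅ σ x) → closure M ρ ≅ closure M σ
    closure-cong M h = types-cong M (λ x → proj₁ (h x)) , tags M
      where
      tags : ∀ M → isApplication (closure M _) ≡ isApplication (closure M _)
      tags (free x) = proj₂ (h x)
      tags (M · N)  = refl
      tags (lam M)  = refl

    module _ (ℓ : Level) where

      magma : Magma ℓ ℓ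
      magma = record
        { Carrier = Lift ℓ Point
        ; _≈_     = λ d e → Lift ℓ (lower d ≅ lower e)
        ; _∙_     = λ d e → lift (apply (lower d) (lower e))
        ; isMagma = record
          { isEquivalence = record
            { refl  = lift (≐-refl , refl)
            ; sym   = λ (lift (p , q)) → lift (≐-sym p , sym q)
            ; trans = λ (lift (p , q)) (lift (p′ , q′)) → lift (≐-trans p p′ , trans q q′)
            }
          ; ∙-cong = λ (lift p) (lift q) →
              lift (Apply-cong (proj₁ p) (proj₁ q) , refl)
          }
        }

      ℐ : InterpretationDomain ℓ
      ℐ = record
        { structure = record
          { 𝒟       = magma
          ; ⟦_⟧     = λ M ρ → lift (closure M (lower ∘ ρ))
          ; ⟦⟧-cong = λ M h → lift (closure-cong M (λ x → lower (h x)))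
          }
        ; Φ   = (λ _ → ⊤) , (λ _ _ → tt)
        ; ƛ∈Φ = λ _ _ _ → tt
        }

      open InterpretationDomain ℐ using (Carrier; Env; Good)

      𝒱 : TypeEnv 𝒯 ℐ
      𝒱 c = (λ d → Lift ℓ (typesᵖ (lower d) (con c)))
          , (λ (lift (p , _)) (lift t) → lift (proj₁ p t))

      mutual
        -- With its converse, this identifies the value of `A` with the points having type `A`. The
        -- two are mutual because an arrow is contravariant in its domain.
        ⟦⟧ᵗ⇒types : ∀ A (d : Carrier) → ⟦_⟧ᵗ 𝒯 ℐ A 𝒱 d → typesᵖ (lower d) A
        ⟦⟧ᵗ⇒types (con (Ω p)) d _ = typesᵖ-closed (lower d) (top p)
        ⟦⟧ᵗ⇒types (con (ν p)) d _ = ⊥-elim-irr (ν∉C p)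
        ⟦⟧ᵗ⇒types (con (ordinary ψ)) d m = lower m
        ⟦⟧ᵗ⇒types (A ⇒ B) d (_ , m) =
          -- Test `d` on the generic point of `A`: all its types lie above `A`, so `η` turns
          -- `A′ ⇒ B` into `A ⇒ B`.
          let A′ , d∈A′⇒B , g∈A′ =
                ⟦⟧ᵗ⇒types B _ (m (lift (gen (just A))) (types⇒⟦⟧ᵗ A _ (incl refl)))
          in typesᵖ-closed (lower d)
               (up (incl d∈A′⇒B) (⇒-mono (principal-least g∈A′) ⊑-refl))
        ⟦⟧ᵗ⇒types (A ∩ B) d (m , m′) =
          typesᵖ-closed (lower d)
            (meet (incl (⟦⟧ᵗ⇒types A d m)) (incl (⟦⟧ᵗ⇒types B d m′)))

        types⇒⟦⟧ᵗ : ∀ A (d : Carrier) → typesᵖ (lower d) A → ⟦_⟧ᵗ 𝒯 ℐ A 𝒱 d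
        types⇒⟦⟧ᵗ (con (Ω p)) d _ = tt
        types⇒⟦⟧ᵗ (con (ν p)) d _ = tt
        types⇒⟦⟧ᵗ (con (ordinary ψ)) d t = lift t
        types⇒⟦⟧ᵗ (A ⇒ B) d t =
          tt , λ e m → types⇒⟦⟧ᵗ B _ (A , t , ⟦⟧ᵗ⇒types A e m)
        types⇒⟦⟧ᵗ (A ∩ B) d t =
            types⇒⟦⟧ᵗ A d (typesᵖ-closed (lower d) (up (incl t) ∩-lowerˡ))
          , types⇒⟦⟧ᵗ B d (typesᵖ-closed (lower d) (up (incl t) ∩-lowerʳ))

      good : ∀ (ρ : Env) → Good ρ
      good ρ = record
        -- The tag of a closed-up variable is by definition that of its value; the tags of `I` and
        -- `I · I` differ.
        { variables  = λ _ → lift (≐-refl , refl)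
        ; nontrivial = I , I · I , λ { (lift (_ , ())) }
        }
        where I = lam (bound zero)

      ∇-good : ∇-Good 𝒯 ℐ 𝒱
      ∇-good = record
        { good-[≔] = λ _ _ _ _ _ _ → good _
        -- The hypothesis at the generic point of `A` already gives the body type `B` under the
        -- binder.
        ; good-ƛ   = λ A B ρ _ M x h → types⇒⟦⟧ᵗ (A ⇒ B) _ (incl (arrow
            (proj₁ (types-close′ A ρ x M)
              (⟦⟧ᵗ⇒types B _ (h (lift (gen (just A))) (types⇒⟦⟧ᵗ A _ (incl refl)))))))
        }
        where
        types-close′ : ∀ A (ρ : Env) x (M : Λ) →
          types M (typesᵖ ∘ lower ∘ (ρ [ x ≔ lift (gen (just A)) ])) Vec.[]
          ≐ types (close x M) (typesᵖ ∘ lower ∘ ρ) (A Vec.∷ Vec.[])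
        types-close′ A ρ x M = types-close (typesᵖ ∘ lower) ρ refl x M refl (λ ())

      agrees : Agrees 𝒯 ℐ 𝒱
      agrees A B A⊑B {d} m =
        types⇒⟦⟧ᵗ B d (typesᵖ-closed (lower d) (up (incl (⟦⟧ᵗ⇒types A d m)) A⊑B))

      complete : ∀ Γ M A → Γ ⊨ₛ[ 𝒯 , ℓ ] M ∶ A → Γ ⊢[ 𝒯 ] M ∶ A
      complete Γ M A ⊨M = types-⊢ Γ M (<-wellFounded _)
        (⟦⟧ᵗ⇒types A _
          (⊨M ℐ 𝒱 (λ _ → tt) ∇-good agrees ρ (good ρ)
            (λ x B Γx → types⇒⟦⟧ᵗ B _ (incl Γx))))
        where
        ρ : Env
        -- In this generic environment the types of `M` are exactly those collected by
        -- `types M (principal ∘ Γ)`.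
        ρ x = lift (gen (Γ x))

  -- Necessity of the conditions.

  module Necessity (ℓ : Level)
    (complete : ∀ Γ M A → Γ ⊨ₛ[ 𝒯 , ℓ ] M ∶ A → Γ ⊢[ 𝒯 ] M ∶ A)
    where

    -- Apply completeness to a variable declared with type `A`, then invert its typing.
    ⊑-from-inclusion : ∀ {A B} →
      (∀ (ℐ : InterpretationDomain ℓ) 𝒱 → InterpretationDomain.Simple ℐ →
       Agrees 𝒯 ℐ 𝒱 → ⟦_⟧ᵗ 𝒯 ℐ A 𝒱 ⊆ ⟦_⟧ᵗ 𝒯 ℐ B 𝒱) →
      A ⊑ B
    ⊑-from-inclusion {A} {B} A⊆B = ⊢-variable {Γ = λ _ → just A} {x = 0} refl
      (complete _ _ B λ ℐ 𝒱 simple _ agrees ρ _ ρ⊨Γ →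
        A⊆B ℐ 𝒱 simple agrees (ρ⊨Γ 0 A refl))

    v⇒∩ : Validates 𝒯 ⇒-∩
    v⇒∩ ax [] = ⊑-from-inclusion λ _ _ _ _ ((X∈Φ , f) , (_ , g)) →
      X∈Φ , λ Y Y∈A → f Y Y∈A , g Y Y∈A

    vη : Validates 𝒯 η
    vη rule (A′⊑A ∷ B⊑B′ ∷ []) = ⊑-from-inclusion λ _ _ _ agrees (X∈Φ , f) →
      X∈Φ , λ Y Y∈A′ → agrees _ _ B⊑B′ (f Y (agrees _ _ A′⊑A Y∈A′))

    vΩη : Validates 𝒯 Ω-η
    vΩη (ax p) [] = ⊑-from-inclusion λ _ _ simple _ _ → simple _ , λ _ _ → tt

    vΩlazy : Validates 𝒯 Ω-lazy
    vΩlazy (ax p) [] = ⊑-trans (Ω-top p) (vΩη (ax p) [])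

    -- In a simple domain `ν` denotes everything, so completeness would type even an undeclared
    -- variable.
    ν∉C : ¬ HasΩ 𝒯 → ¬ Hasν 𝒯
    ν∉C Ω∉C ν∈ = undeclared-untypable {Γ = λ _ → nothing} {x = 0} Ω∉C refl
      (complete _ _ (con (ν ν∈)) λ _ _ simple _ _ _ _ _ → simple _)

-- Both directions, by cases on the presence of `Ω`.

theorem5p16 : (ℓ : Level) (𝒯 : TypeTheory) →
    (∀ (Γ : Basis 𝒯) (M : Λ) (A : Ty 𝒯) → Γ ⊨ₛ[ 𝒯 , ℓ ] M ∶ A → Γ ⊢[ 𝒯 ] M ∶ A)
    ⇔ ((Strict 𝒯 × ¬ Hasν 𝒯) ⊎ (Natural 𝒯 × Validates 𝒯 Ω-η))
theorem5p16 ℓ 𝒯 = mk⇔ necessary [ strict , natural ]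
  where
  open TypeTheory 𝒯

  Complete : Set _
  Complete = ∀ Γ M A → Γ ⊨ₛ[ 𝒯 , ℓ ] M ∶ A → Γ ⊢[ 𝒯 ] M ∶ A

  necessary : Complete → (Strict 𝒯 × ¬ Hasν 𝒯) ⊎ (Natural 𝒯 × Validates 𝒯 Ω-η)
  necessary complete with T? (Constants.hasΩ C)
  ... | yes Ω∈ = inj₂
    ( record { Ω∈ = Ω∈ ; v⇒∩ = v⇒∩ ; vη = vη
             ; vΩ = λ { (ax p) [] → Ω-top 𝒯 p } ; vΩlazy = vΩlazy }
    , vΩη)
    where open Necessity 𝒯 ℓ complete
  ... | no Ω∉ = inj₁ (record { Ω∉C = Ω∉ ; v⇒∩ = v⇒∩ ; vη = vη } , ν∉C Ω∉)
    where open Necessity 𝒯 ℓ complete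

  strict : Strict 𝒯 × ¬ Hasν 𝒯 → Complete
  strict (s , ν∉) = FilterModel.complete 𝒯 v⇒∩ vη (λ p → ⊥-elim-irr (Ω∉C p)) ν∉ ℓ
    where open Strict s

  natural : Natural 𝒯 × Validates 𝒯 Ω-η → Complete
  natural (n , vΩη) =
    -- Here `ν` is excluded because `Ω` and `ν` never occur together.
    FilterModel.complete 𝒯 v⇒∩ vη (λ p → vΩη (ax p) []) (λ ν∈ → ¬Ω×ν (Ω∈ , ν∈)) ℓ
    where open Natural n
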